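{- Contextual equivalence $=_{\mathcal C}^{\mathrm{VSC}}$ of the VSC is a scrutable VSC-theory.
   Context: Value substitution calculus (VSC). Terms (the set $\Lambda_{\mathsf{vsc}}$) are $t,u,s ::= v \mid tu \mid t[x{\leftarrow}u]$ and values are $v ::= x \mid \lambda x.t$; $t[x{\leftarrow}u]$ is an explicit substitution (ES), binding $x$ in $t$. Terms are identified up to $\alpha$-renaming; $t\{x{\leftarrow}u\}$ is capture-avoiding (meta-level) substitution. Contexts are terms with exactly one hole $\langle\cdot\rangle$; plugging $C\langle t\rangle$ may capture variables. Substitution contexts: $L ::= \langle\cdot\rangle \mid L[x{\leftarrow}t]$. Root rules: $L\langle\lambda x.t\rangle u \mapsto_{\mathsf m} L\langle t[x{\leftarrow}u]\rangle$ and $t[x{\leftarrow}L\langle v\rangle] \mapsto_{\mathsf e} L\langle t\{x{\leftarrow}v\}\rangle$ with $v$ a value, where (by $\alpha$-renaming) $L$ captures no free variable of $u$, resp. of $t$. Full contexts: $F ::= \langle\cdot\rangle \mid Ft \mid tF \mid \lambda x.F \mid F[x{\leftarrow}t] \mid t[x{\leftarrow}F]$. The reduction $\to_{\mathsf{vsc}}$ is the closure of $\mapsto_{\mathsf m}\cup\mapsto_{\mathsf e}$ under full contexts. Contextual equivalence: $t =_{\mathcal C}^{\mathrm{VSC}} u$ iff for every context $C$ such that $C\langle t\rangle$ and $C\langle u\rangle$ are closed: $C\langle t\rangle \to_{\mathsf{vsc}}^* v$ for some value $v$ if and only if $C\langle u\rangle\to_{\mathsf{vsc}}^* v'$ for some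 value $v'$. A VSC-theory is an equivalence relation on $\Lambda_{\mathsf{vsc}}$ containing $\to_{\mathsf{vsc}}$ and closed under all contexts of the VSC. Testing contexts: $T ::= \langle\cdot\rangle \mid (\lambda x.T)t \mid Tt$ with $t\in\Lambda_{\mathsf{vsc}}$. A term $t$ is (CbV) scrutable if $T\langle t\rangle\to_{\mathsf{vsc}}^* v$ for some testing context $T$ and some value $v$, and inscrutable otherwise. A VSC-theory is scrutable if it equates all inscrutable terms of $\Lambda_{\mathsf{vsc}}$. -}

module Defs where

open import Data.Fin.Base using (Fin; zero; suc; lift)
open import Data.Nat.Base using (ℕ; zero; suc)
open import Data.Product.Base using (∃; ∃-syntax; _×_)
open import Function.Base using (id; _∘_)
open import Function.Bundles using (_⇔_; _↣_; module Injection)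
open import Level using (Level; 0ℓ; _⊔_)
open import Relation.Binary.Core using (Rel; _⇒_)
open import Relation.Binary.Structures using (IsEquivalence)
open import Relation.Binary.Construct.Closure.ReflexiveTransitive using (Star)
open import Relation.Nullary.Negation.Core using (¬_)

private
  variable
    n m k : ℕ
    ℓ : Level

infixl 7 _·_
infixl 8 _[←_]

-- Terms up to α-renaming, as well-scoped de Bruijn terms: Tm n consists of the
-- terms whose free variables are among n given names.  In t [← u], the explicit
-- substitution binds variable zero of t.

data Tm (n : ℕ) : Set where
  var   : Fin n → Tm n
  ƛ     : Tm (suc n) → Tm n
  _·_   : Tm n → Tm n → Tm n
  _[←_] : Tm (suc n) → Tm n → Tm n

data Value {n : ℕ} : Tm n → Set where
  var : (x : Fin n) → Value (var x)
  ƛ   : (t : Tm (suc n)) → Value (ƛ t)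

infix 4 _∈fv_

data _∈fv_ {n : ℕ} (x : Fin n) : Tm n → Set where
  var    : x ∈fv var x
  ƛ      : ∀ {t} → suc x ∈fv t → x ∈fv ƛ t
  appˡ   : ∀ {t u} → x ∈fv t → x ∈fv t · u
  appʳ   : ∀ {t u} → x ∈fv u → x ∈fv t · u
  esBody : ∀ {t u} → suc x ∈fv t → x ∈fv t [← u ]
  esArg  : ∀ {t u} → x ∈fv u → x ∈fv t [← u ]

Closed : Tm n → Set
Closed t = ∀ x → ¬ (x ∈fv t)

rename : (Fin n → Fin m) → Tm n → Tm m
rename ρ (var x)    = var (ρ x)
rename ρ (ƛ t)      = ƛ (rename (lift 1 ρ) t)
rename ρ (t · u)    = rename ρ t · rename ρ u
rename ρ (t [← u ]) = rename (lift 1 ρ) t [← rename ρ u ]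

exts : (Fin n → Tm m) → Fin (suc n) → Tm (suc m)
exts σ zero    = var zero
exts σ (suc x) = rename suc (σ x)

subst : (Fin n → Tm m) → Tm n → Tm m
subst σ (var x)    = σ x
subst σ (ƛ t)      = ƛ (subst (exts σ) t)
subst σ (t · u)    = subst σ t · subst σ u
subst σ (t [← u ]) = subst (exts σ) t [← subst σ u ]

single : Tm n → Fin (suc n) → Tm n
single u zero    = u
single u (suc x) = var x

infixl 8 _⟪_⟫

-- Meta-level substitution of u for variable zero.
_⟪_⟫ : Tm (suc n) → Tm n → Tm n
t ⟪ u ⟫ = subst (single u) t

-- Substitution contexts with outer scope n and hole scope k.

data SubCtx (n : ℕ) : ℕ → Set where
  ⟨·⟩   : SubCtx n n
  _[←_] : SubCtx (suc n) k → Tm n → SubCtx n k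

infix 9 _⟨_⟩ˢ

_⟨_⟩ˢ : SubCtx n k → Tm k → Tm n
⟨·⟩        ⟨ t ⟩ˢ = t
(L [← u ]) ⟨ t ⟩ˢ = (L ⟨ t ⟩ˢ) [← u ]

-- Moving a term inside L without capture.
under : SubCtx n k → Fin n → Fin k
under ⟨·⟩        = id
under (L [← u ]) = under L ∘ suc

infix 4 _↦ₘ_ _↦ₑ_ _⟶_ _⟶*_

data _↦ₘ_ {n : ℕ} : Rel (Tm n) 0ℓ where
  mult : (L : SubCtx n k) (t : Tm (suc k)) (u : Tm n) →
         L ⟨ ƛ t ⟩ˢ · u ↦ₘ L ⟨ t [← rename (under L) u ] ⟩ˢ

data _↦ₑ_ {n : ℕ} : Rel (Tm n) 0ℓ where
  expo : (L : SubCtx n k) (t : Tm (suc n)) {v : Tm k} → Value v →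
         t [← L ⟨ v ⟩ˢ ] ↦ₑ L ⟨ rename (lift 1 (under L)) t ⟪ v ⟫ ⟩ˢ

-- Closure of the root rules under full contexts: one congruence rule for each
-- production of the grammar of full contexts.

data _⟶_ {n : ℕ} : Rel (Tm n) 0ℓ where
  rootₘ  : ∀ {t u} → t ↦ₘ u → t ⟶ u
  rootₑ  : ∀ {t u} → t ↦ₑ u → t ⟶ u
  appˡ   : ∀ {t t′ u} → t ⟶ t′ → t · u ⟶ t′ · u
  appʳ   : ∀ {t u u′} → u ⟶ u′ → t · u ⟶ t · u′
  ƛ      : ∀ {t t′} → t ⟶ t′ → ƛ t ⟶ ƛ t′
  esBody : ∀ {t t′ u} → t ⟶ t′ → t [← u ] ⟶ t′ [← u ]
  esArg  : ∀ {t u u′} → u ⟶ u′ → t [← u ] ⟶ t [← u′ ]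

_⟶*_ : Rel (Tm n) 0ℓ
_⟶*_ = Star _⟶_

infix 5 _⇓

_⇓ : Tm n → Set
t ⇓ = ∃[ v ] (t ⟶* v × Value v)

-- One-hole contexts plugged with terms of Tm n and yielding terms of Tm m.
-- Plugging may capture.  In named syntax, a context may bind the free variables
-- of the plugged term in any order, and may have further binders which capture
-- none of them; so the hole records which variable in scope each of the n names
-- refers to.  Distinct names refer to distinct variables, hence the injectivity.

data Ctx (n m : ℕ) : Set where
  hole   : Fin n ↣ Fin m → Ctx n m
  appˡ   : Ctx n m → Tm m → Ctx n m
  appʳ   : Tm m → Ctx n m → Ctx n m
  ƛ      : Ctx n (suc m) → Ctx n m
  esBody : Ctx n (suc m) → Tm m → Ctx n m
  esArg  : Tm (suc m) → Ctx n m → Ctx n m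

infix 9 _⟨_⟩

_⟨_⟩ : Ctx n m → Tm n → Tm m
hole ρ     ⟨ t ⟩ = rename (Injection.to ρ) t
appˡ C u   ⟨ t ⟩ = C ⟨ t ⟩ · u
appʳ u C   ⟨ t ⟩ = u · C ⟨ t ⟩
ƛ C        ⟨ t ⟩ = ƛ (C ⟨ t ⟩)
esBody C u ⟨ t ⟩ = C ⟨ t ⟩ [← u ]
esArg u C  ⟨ t ⟩ = u [← C ⟨ t ⟩ ]

infix 4 _=C_

-- Closedness is a hypothesis rather than m = 0, because names of the scope that
-- occur neither in t nor in u need not be captured.
_=C_ : Rel (Tm n) 0ℓ
_=C_ {n} t u = ∀ {m} (C : Ctx n m) → Closed (C ⟨ t ⟩) → Closed (C ⟨ u ⟩) →
               (C ⟨ t ⟩ ⇓) ⇔ (C ⟨ u ⟩ ⇓)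

-- A relation on terms is given as a family over scopes; terms with different
-- free variables are compared in a common scope.
TermRel : (ℓ : Level) → Set (Level.suc ℓ)
TermRel ℓ = (n : ℕ) → Rel (Tm n) ℓ

record IsVSCTheory (R : TermRel ℓ) : Set ℓ where
  field
    isEquivalence : IsEquivalence (R n)
    contains-⟶    : _⟶_ {n} ⇒ R n
    closed        : (C : Ctx n m) {t u : Tm n} → R n t u → R m (C ⟨ t ⟩) (C ⟨ u ⟩)

data Testing {n m : ℕ} : Ctx n m → Set where
  hole : (ρ : Fin n ↣ Fin m) → Testing (hole ρ)
  beta : {T : Ctx n (suc m)} → Testing T → (t : Tm m) → Testing (appˡ (ƛ T) t)
  app  : {T : Ctx n m} → Testing T → (t : Tm m) → Testing (appˡ T t)

Scrutable : Tm n → Set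
Scrutable {n} t = ∃[ m ] ∃[ T ] (Testing {n} {m} T × T ⟨ t ⟩ ⇓)

Inscrutable : Tm n → Set
Inscrutable t = ¬ Scrutable t

record IsScrutableVSCTheory (R : TermRel ℓ) : Set ℓ where
  field
    isVSCTheory         : IsVSCTheory R
    equates-inscrutable : {t u : Tm n} → Inscrutable t → Inscrutable u → R n t u

{-# OPTIONS --safe #-}
-- Evaluate closed terms by a weak big-step semantics, t ⇩ b meaning that t has
-- value ƛ b, and compare open terms by the Kleene preorder: t ⊑ u if, under every
-- closing value substitution, every value of t is also a value of u.  The steps of
-- the calculus are equivalences for ⊑, and an inscrutable term is ⊑-below every
-- term, because a value of one of its value instances would be the outcome of the
-- testing context that feeds it these values.  A Howe-style closure of ⊑ is a
-- simulation for ⇩, so ⊑ implies the contextual preorder of ⇩.  Moreover ⇩ agrees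
-- with ⟶* on closed terms: one direction replays ⇩ in ⟶, the other propagates
-- termination backwards along ⟶, whose inverse is contained in the closure.
module Submission where

open import Defs
open import Data.Fin.Base using (Fin; zero; suc; lift)
open import Data.Fin.Properties using (lift-injective)
open import Data.Nat.Base using (ℕ; zero; suc)
open import Data.Product.Base using (∃; _×_; _,_)
open import Function.Base using (_∘_; const)
open import Function.Bundles using (_⇔_; _↣_; mk⇔; mk↣; module Injection)
open import Function.Construct.Composition using (_↣-∘_)
open import Function.Construct.Identity using (↣-id)
import Function.Properties.Equivalence as ⇔
open import Relation.Binary.Construct.Closure.ReflexiveTransitive using (ε; _◅_; _◅◅_; gmap)
open import Relation.Binary.PropositionalEquality
  using (_≡_; refl; sym; trans; cong; cong₂; module ≡-Reasoning) renaming (subst to transport)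
open import Relation.Nullary.Negation.Core using (contradiction)

private
  variable
    n m k : ℕ

-- Renaming and substitution

exts-cong : {σ τ : Fin n → Tm m} {P : Fin (suc n) → Set} → (∀ x → P (suc x) → σ x ≡ τ x) →
            ∀ x → P x → exts σ x ≡ exts τ x
exts-cong e zero    _ = refl
exts-cong e (suc x) p = cong (rename suc) (e x p)

-- `Closed` is a condition on free occurrences in any scope, so `subst-closed` needs agreement asked
-- only at names that occur free.
subst-cong-fv : {σ τ : Fin n → Tm m} (t : Tm n) → (∀ x → x ∈fv t → σ x ≡ τ x) →
                subst σ t ≡ subst τ t
subst-cong-fv (var x)    e = e x var
subst-cong-fv (ƛ t)      e = cong ƛ (subst-cong-fv t (exts-cong λ x → e x ∘ ƛ))
subst-cong-fv (t · u)    e =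
  cong₂ _·_ (subst-cong-fv t λ x → e x ∘ appˡ) (subst-cong-fv u λ x → e x ∘ appʳ)
subst-cong-fv (t [← u ]) e =
  cong₂ _[←_] (subst-cong-fv t (exts-cong λ x → e x ∘ esBody)) (subst-cong-fv u λ x → e x ∘ esArg)

subst-cong : {σ τ : Fin n → Tm m} (t : Tm n) → (∀ x → σ x ≡ τ x) → subst σ t ≡ subst τ t
subst-cong t e = subst-cong-fv t λ x _ → e x

exts-var : {σ : Fin n → Tm n} → (∀ x → σ x ≡ var x) → ∀ x → exts σ x ≡ var x
exts-var e zero    = refl
exts-var e (suc x) = cong (rename suc) (e x)

subst-id : {σ : Fin n → Tm n} (t : Tm n) → (∀ x → σ x ≡ var x) → subst σ t ≡ t
subst-id (var x)    e = e x
subst-id (ƛ t)      e = cong ƛ (subst-id t (exts-var e))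
subst-id (t · u)    e = cong₂ _·_ (subst-id t e) (subst-id u e)
subst-id (t [← u ]) e = cong₂ _[←_] (subst-id t (exts-var e)) (subst-id u e)

subst-closed : {σ : Fin n → Tm n} (t : Tm n) → Closed t → subst σ t ≡ t
subst-closed t c =
  trans (subst-cong-fv t λ x x∈ → contradiction x∈ (c x)) (subst-id t λ _ → refl)

exts-lift : {σ : Fin n → Tm m} {ρ : Fin k → Fin n} {τ : Fin k → Tm m} →
            (∀ x → σ (ρ x) ≡ τ x) → ∀ x → exts σ (lift 1 ρ x) ≡ exts τ x
exts-lift e zero    = refl
exts-lift e (suc x) = cong (rename suc) (e x)

-- Here and in the later fusion laws the composite is a third function agreeing pointwise, so that
-- the induction passes under binders without function extensionality.
subst-rename : {σ : Fin n → Tm m} {ρ : Fin k → Fin n} {τ : Fin k → Tm m} (t : Tm k) →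
               (∀ x → σ (ρ x) ≡ τ x) → subst σ (rename ρ t) ≡ subst τ t
subst-rename (var x)    e = e x
subst-rename (ƛ t)      e = cong ƛ (subst-rename t (exts-lift e))
subst-rename (t · u)    e = cong₂ _·_ (subst-rename t e) (subst-rename u e)
subst-rename (t [← u ]) e = cong₂ _[←_] (subst-rename t (exts-lift e)) (subst-rename u e)

var-lift : {ρ : Fin n → Fin m} {σ : Fin n → Tm m} →
           (∀ x → var (ρ x) ≡ σ x) → ∀ x → var (lift 1 ρ x) ≡ exts σ x
var-lift e zero    = refl
var-lift e (suc x) = cong (rename suc) (e x)

rename-as-subst : {ρ : Fin n → Fin m} {σ : Fin n → Tm m} (t : Tm n) →
                  (∀ x → var (ρ x) ≡ σ x) → rename ρ t ≡ subst σ t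
rename-as-subst (var x)    e = e x
rename-as-subst (ƛ t)      e = cong ƛ (rename-as-subst t (var-lift e))
rename-as-subst (t · u)    e = cong₂ _·_ (rename-as-subst t e) (rename-as-subst u e)
rename-as-subst (t [← u ]) e = cong₂ _[←_] (rename-as-subst t (var-lift e)) (rename-as-subst u e)

rename-id : {ρ : Fin n → Fin n} (t : Tm n) → (∀ x → ρ x ≡ x) → rename ρ t ≡ t
rename-id t e = trans (rename-as-subst t λ _ → refl) (subst-id t λ x → cong var (e x))

rename-rename : {ρ : Fin n → Fin m} {θ : Fin k → Fin n} {ξ : Fin k → Fin m} (t : Tm k) →
                (∀ x → ρ (θ x) ≡ ξ x) → rename ρ (rename θ t) ≡ rename ξ t
rename-rename {ρ = ρ} {θ} {ξ} t e = begin
  rename ρ (rename θ t)        ≡⟨ rename-as-subst (rename θ t) (λ _ → refl) ⟩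
  subst (var ∘ ρ) (rename θ t) ≡⟨ subst-rename t (λ x → cong var (e x)) ⟩
  subst (var ∘ ξ) t            ≡⟨ rename-as-subst t (λ _ → refl) ⟨
  rename ξ t                   ∎
  where open ≡-Reasoning

rename-suc : (ρ : Fin n → Fin m) (t : Tm n) →
             rename (lift 1 ρ) (rename suc t) ≡ rename suc (rename ρ t)
rename-suc ρ t = trans (rename-rename t λ _ → refl) (sym (rename-rename t λ _ → refl))

lift-exts : {ρ : Fin n → Fin m} {σ : Fin k → Tm n} {τ : Fin k → Tm m} →
            (∀ x → rename ρ (σ x) ≡ τ x) → ∀ x → rename (lift 1 ρ) (exts σ x) ≡ exts τ x
lift-exts         e zero    = refl
lift-exts {ρ = ρ} {σ} e (suc x) = trans (rename-suc ρ (σ x)) (cong (rename suc) (e x))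

rename-subst : {ρ : Fin n → Fin m} {σ : Fin k → Tm n} {τ : Fin k → Tm m} (t : Tm k) →
               (∀ x → rename ρ (σ x) ≡ τ x) → rename ρ (subst σ t) ≡ subst τ t
rename-subst (var x)    e = e x
rename-subst (ƛ t)      e = cong ƛ (rename-subst t (lift-exts e))
rename-subst (t · u)    e = cong₂ _·_ (rename-subst t e) (rename-subst u e)
rename-subst (t [← u ]) e = cong₂ _[←_] (rename-subst t (lift-exts e)) (rename-subst u e)

exts-exts : {σ : Fin n → Tm m} {τ : Fin k → Tm n} {υ : Fin k → Tm m} →
            (∀ x → subst σ (τ x) ≡ υ x) → ∀ x → subst (exts σ) (exts τ x) ≡ exts υ x
exts-exts             e zero    = refl
exts-exts {τ = τ} e (suc x) =
  trans (subst-rename (τ x) λ _ → refl)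
        (trans (sym (rename-subst (τ x) λ _ → refl)) (cong (rename suc) (e x)))

subst-subst : {σ : Fin n → Tm m} {τ : Fin k → Tm n} {υ : Fin k → Tm m} (t : Tm k) →
              (∀ x → subst σ (τ x) ≡ υ x) → subst σ (subst τ t) ≡ subst υ t
subst-subst (var x)    e = e x
subst-subst (ƛ t)      e = cong ƛ (subst-subst t (exts-exts e))
subst-subst (t · u)    e = cong₂ _·_ (subst-subst t e) (subst-subst u e)
subst-subst (t [← u ]) e = cong₂ _[←_] (subst-subst t (exts-exts e)) (subst-subst u e)

infixr 5 _∷ˢ_

_∷ˢ_ : Tm m → (Fin n → Tm m) → Fin (suc n) → Tm m
(u ∷ˢ σ) zero    = u
(u ∷ˢ σ) (suc x) = σ x

subst-exts-⟪⟫ : (σ : Fin n → Tm m) (t : Tm (suc n)) (u : Tm m) →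
                subst (exts σ) t ⟪ u ⟫ ≡ subst (u ∷ˢ σ) t
subst-exts-⟪⟫ σ t u = subst-subst t λ where
  zero    → refl
  (suc x) → trans (subst-rename (σ x) λ _ → refl) (subst-id (σ x) λ _ → refl)

subst-⟪⟫ : (σ : Fin n → Tm m) (t : Tm (suc n)) (u : Tm n) →
           subst σ (t ⟪ u ⟫) ≡ subst (subst σ u ∷ˢ σ) t
subst-⟪⟫ σ t u = subst-subst t λ where
  zero    → refl
  (suc x) → refl

rename-⟪⟫ : (ρ : Fin n → Fin m) (t : Tm (suc n)) (u : Tm n) →
            rename ρ (t ⟪ u ⟫) ≡ rename (lift 1 ρ) t ⟪ rename ρ u ⟫
rename-⟪⟫ ρ t u = trans
  (rename-subst {τ = rename ρ u ∷ˢ (var ∘ ρ)} t λ { zero → refl ; (suc _) → refl })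
  (sym (subst-rename t λ { zero → refl ; (suc _) → refl }))

Value-rename : {v : Tm n} (ρ : Fin n → Fin m) → Value v → Value (rename ρ v)
Value-rename ρ (var x) = var (ρ x)
Value-rename ρ (ƛ t)   = ƛ (rename (lift 1 ρ) t)

Value-subst : {v : Tm n} {σ : Fin n → Tm m} → (∀ x → Value (σ x)) → Value v → Value (subst σ v)
Value-subst         vσ (var x) = vσ x
Value-subst {σ = σ} vσ (ƛ t)   = ƛ (subst (exts σ) t)

Value-exts : {σ : Fin n → Tm m} → (∀ x → Value (σ x)) → ∀ x → Value (exts σ x)
Value-exts vσ zero    = var zero
Value-exts vσ (suc x) = Value-rename suc (vσ x)

Value-∷ˢ : {v : Tm m} {σ : Fin n → Tm m} → Value v → (∀ x → Value (σ x)) → ∀ x → Value ((v ∷ˢ σ) x)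
Value-∷ˢ v vσ zero    = v
Value-∷ˢ v vσ (suc x) = vσ x

-- Big-step evaluation

infix 4 _⇩_

data _⇩_ {n : ℕ} : Tm n → Tm (suc n) → Set where
  ƛ   : ∀ {b} → ƛ b ⇩ b
  app : ∀ {t u b c d} → t ⇩ b → u ⇩ c → b ⟪ ƛ c ⟫ ⇩ d → t · u ⇩ d
  es  : ∀ {t u c d} → u ⇩ c → t ⟪ ƛ c ⟫ ⇩ d → t [← u ] ⇩ d

-- Serves to carry an evaluation in scope 0 back to the scope of a closed term.
⇩-rename : {t : Tm n} {b : Tm (suc n)} (ρ : Fin n → Fin m) →
           t ⇩ b → rename ρ t ⇩ rename (lift 1 ρ) b
⇩-rename ρ ƛ                             = ƛ
⇩-rename ρ (app {b = b} {c = c} t⇩ u⇩ d⇩) =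
  app (⇩-rename ρ t⇩) (⇩-rename ρ u⇩) (transport (_⇩ _) (rename-⟪⟫ ρ b (ƛ c)) (⇩-rename ρ d⇩))
⇩-rename ρ (es {t = t} {c = c} u⇩ d⇩)     =
  es (⇩-rename ρ u⇩) (transport (_⇩ _) (rename-⟪⟫ ρ t (ƛ c)) (⇩-rename ρ d⇩))

es-⟶ : (t : Tm (suc n)) (c : Tm (suc n)) → t [← ƛ c ] ⟶ t ⟪ ƛ c ⟫
es-⟶ t c = transport (λ s → t [← ƛ c ] ⟶ s ⟪ ƛ c ⟫)
  (rename-id t λ { zero → refl ; (suc _) → refl }) (rootₑ (expo ⟨·⟩ t (ƛ c)))

app-⟶ : (b : Tm (suc n)) (u : Tm n) → ƛ b · u ⟶ b [← u ]
app-⟶ b u = transport (λ s → ƛ b · u ⟶ b [← s ])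
  (rename-id u λ _ → refl) (rootₘ (mult ⟨·⟩ b u))

⇩⇒⟶* : {t : Tm n} {b : Tm (suc n)} → t ⇩ b → t ⟶* ƛ b
⇩⇒⟶* ƛ                                     = ε
⇩⇒⟶* (app {u = u} {b = b} {c = c} t⇩ u⇩ d⇩) =
  -- The multiplicative step fires before the argument is evaluated; the argument then runs inside
  -- the explicit substitution until it is an abstraction.
  gmap (_· u) appˡ (⇩⇒⟶* t⇩) ◅◅ app-⟶ b u ◅
  gmap (b [←_]) esArg (⇩⇒⟶* u⇩) ◅◅ es-⟶ b c ◅ ⇩⇒⟶* d⇩
⇩⇒⟶* (es {t = t} {c = c} u⇩ d⇩)             =
  gmap (t [←_]) esArg (⇩⇒⟶* u⇩) ◅◅ es-⟶ t c ◅ ⇩⇒⟶* d⇩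

Value⇒⇩ : {v : Tm 0} → Value v → ∃ λ b → v ≡ ƛ b × v ⇩ b
Value⇒⇩ (ƛ b) = b , refl , ƛ

-- The Kleene preorder

infix 4 _⊑_

-- Asking for the same body `b`, rather than mere termination, keeps the outcome fixed when ⊑ is
-- composed with a simulation; the price is that ⊑ is not compatible with `ƛ`.
_⊑_ : Tm n → Tm n → Set
_⊑_ {n} t u = (σ : Fin n → Tm 0) → (∀ x → Value (σ x)) → ∀ {b} → subst σ t ⇩ b → subst σ u ⇩ b

⊑-rename : {t u : Tm n} (ρ : Fin n → Fin m) → t ⊑ u → rename ρ t ⊑ rename ρ u
⊑-rename {t = t} {u} ρ t⊑u σ vσ t⇩ =
  transport (_⇩ _) (sym (subst-rename u λ _ → refl))
    (t⊑u (σ ∘ ρ) (vσ ∘ ρ) (transport (_⇩ _) (subst-rename t λ _ → refl) t⇩))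

⊑-subst : {t u : Tm n} {τ : Fin n → Tm m} → (∀ x → Value (τ x)) → t ⊑ u → subst τ t ⊑ subst τ u
⊑-subst {t = t} {u} {τ} vτ t⊑u σ vσ t⇩ =
  transport (_⇩ _) (sym (subst-subst u λ _ → refl))
    (t⊑u (subst σ ∘ τ) (Value-subst vσ ∘ vτ) (transport (_⇩ _) (subst-subst t λ _ → refl) t⇩))

-- Extends L σ σ′: evaluating L under the closing substitution σ of its outer scope
-- produces the closing substitution σ′ of its hole scope.
data Extends {k : ℕ} : SubCtx n k → (Fin n → Tm 0) → (Fin k → Tm 0) → Set where
  ⟨·⟩   : ∀ {σ} → Extends ⟨·⟩ σ σ
  _[←_] : ∀ {L : SubCtx (suc n) k} {u σ σ′ c} →
          Extends L (ƛ c ∷ˢ σ) σ′ → subst σ u ⇩ c → Extends (L [← u ]) σ σ′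

Extends-Value : {L : SubCtx n k} {σ : Fin n → Tm 0} {σ′ : Fin k → Tm 0} → Extends L σ σ′ →
                (∀ x → Value (σ x)) → ∀ x → Value (σ′ x)
Extends-Value ⟨·⟩                vσ = vσ
Extends-Value (_[←_] {c = c} e _) vσ = Extends-Value e (Value-∷ˢ (ƛ c) vσ)

Extends-under : {L : SubCtx n k} {σ : Fin n → Tm 0} {σ′ : Fin k → Tm 0} → Extends L σ σ′ →
                ∀ x → σ′ (under L x) ≡ σ x
Extends-under ⟨·⟩        x = refl
Extends-under (e [← _ ]) x = Extends-under e (suc x)

-- Evaluation works off the explicit substitutions of `L` from the outside in; their values,
-- collected in `σ′`, close the term in the hole.
⟨⟩ˢ-⇩⁻ : (L : SubCtx n k) {σ : Fin n → Tm 0} (t : Tm k) {d : Tm 1} → subst σ (L ⟨ t ⟩ˢ) ⇩ d →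
         ∃ λ σ′ → Extends L σ σ′ × subst σ′ t ⇩ d
⟨⟩ˢ-⇩⁻ ⟨·⟩ t t⇩ = _ , ⟨·⟩ , t⇩
⟨⟩ˢ-⇩⁻ (L [← u ]) {σ} t (es {c = c} u⇩ d⇩)
  with σ′ , e , t⇩ ← ⟨⟩ˢ-⇩⁻ L t (transport (_⇩ _) (subst-exts-⟪⟫ σ (L ⟨ t ⟩ˢ) (ƛ c)) d⇩)
  = σ′ , e [← u⇩ ] , t⇩

⟨⟩ˢ-⇩⁺ : {L : SubCtx n k} {σ : Fin n → Tm 0} {σ′ : Fin k → Tm 0} (t : Tm k) {d : Tm 1} →
         Extends L σ σ′ → subst σ′ t ⇩ d → subst σ (L ⟨ t ⟩ˢ) ⇩ d
⟨⟩ˢ-⇩⁺         t ⟨·⟩ t⇩ = t⇩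
⟨⟩ˢ-⇩⁺ {σ = σ} t (_[←_] {L = L} {c = c} e u⇩) t⇩ =
  es u⇩ (transport (_⇩ _) (sym (subst-exts-⟪⟫ σ (L ⟨ t ⟩ˢ) (ƛ c))) (⟨⟩ˢ-⇩⁺ t e t⇩))

↦ₘ⇒⊑ : {t u : Tm n} → t ↦ₘ u → t ⊑ u
↦ₘ⇒⊑ (mult L t u) σ vσ (app s⇩ u⇩ d⇩) with σ′ , e , ƛ ← ⟨⟩ˢ-⇩⁻ L (ƛ t) s⇩ =
  -- Moving `u` inside `L` avoids capture, so `σ′` gives the moved copy the same instance that `σ`
  -- gives `u`.
  ⟨⟩ˢ-⇩⁺ (t [← _ ]) e (es (transport (_⇩ _) (sym (subst-rename u (Extends-under e))) u⇩) d⇩)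

↦ₘ⇒⊒ : {t u : Tm n} → t ↦ₘ u → u ⊑ t
↦ₘ⇒⊒ (mult L t u) σ vσ s⇩ with σ′ , e , es u⇩ d⇩ ← ⟨⟩ˢ-⇩⁻ L (t [← _ ]) s⇩ =
  app (⟨⟩ˢ-⇩⁺ (ƛ t) e ƛ) (transport (_⇩ _) (subst-rename u (Extends-under e)) u⇩) d⇩

-- Once `L` is evaluated, the reduct is exactly the term that the `es` rule goes on to evaluate for
-- the redex; both directions of the exponential step rest on this.
expo-subst : {L : SubCtx n k} {σ : Fin n → Tm 0} {σ′ : Fin k → Tm 0} (t : Tm (suc n)) {v : Tm k} {c : Tm 1} →
             Extends L σ σ′ → subst σ′ v ≡ ƛ c →
             subst σ′ (rename (lift 1 (under L)) t ⟪ v ⟫) ≡ subst (exts σ) t ⟪ ƛ c ⟫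
expo-subst {L = L} {σ} {σ′} t {v} {c} e eq = begin
  subst σ′ (t′ ⟪ v ⟫)           ≡⟨ subst-⟪⟫ σ′ t′ v ⟩
  subst (subst σ′ v ∷ˢ σ′) t′   ≡⟨ subst-rename t (λ { zero → eq ; (suc x) → Extends-under e x }) ⟩
  subst (ƛ c ∷ˢ σ) t            ≡⟨ subst-exts-⟪⟫ σ t (ƛ c) ⟨
  subst (exts σ) t ⟪ ƛ c ⟫      ∎
  where
  open ≡-Reasoning
  t′ = rename (lift 1 (under L)) t

Value-⇩⁻ : {v : Tm 0} {c : Tm 1} → Value v → v ⇩ c → v ≡ ƛ c
Value-⇩⁻ (ƛ _) ƛ = refl

↦ₑ⇒⊑ : {t u : Tm n} → t ↦ₑ u → t ⊑ u
↦ₑ⇒⊑ (expo L t {v} val) σ vσ (es s⇩ d⇩) with σ′ , e , v⇩ ← ⟨⟩ˢ-⇩⁻ L v s⇩ =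
  ⟨⟩ˢ-⇩⁺ (rename (lift 1 (under L)) t ⟪ v ⟫) e (transport (_⇩ _) (sym (expo-subst t e eq)) d⇩)
  where eq = Value-⇩⁻ (Value-subst (Extends-Value e vσ) val) v⇩

↦ₑ⇒⊒ : {t u : Tm n} → t ↦ₑ u → u ⊑ t
↦ₑ⇒⊒ (expo L t {v} val) σ vσ s⇩
  with σ′ , e , d⇩ ← ⟨⟩ˢ-⇩⁻ L (rename (lift 1 (under L)) t ⟪ v ⟫) s⇩
  with c , eq , v⇩ ← Value⇒⇩ (Value-subst (Extends-Value e vσ) val)
  = es (⟨⟩ˢ-⇩⁺ v e v⇩) (transport (_⇩ _) (expo-subst t e eq) d⇩)

-- The Howe-style closure of the Kleene preorder

infix 4 _≲_

-- Compatibility is built in, which ⊑ lacks, and `_then_` absorbs ⊑ on the right as in Howe's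
-- method.
data _≲_ {n : ℕ} : Tm n → Tm n → Set where
  var    : ∀ x → var x ≲ var x
  ƛ      : ∀ {t t′} → t ≲ t′ → ƛ t ≲ ƛ t′
  _·_    : ∀ {t t′ u u′} → t ≲ t′ → u ≲ u′ → t · u ≲ t′ · u′
  es     : ∀ {t t′ u u′} → t ≲ t′ → u ≲ u′ → t [← u ] ≲ t′ [← u′ ]
  _then_ : ∀ {t u s} → t ≲ u → u ⊑ s → t ≲ s

≲-refl : (t : Tm n) → t ≲ t
≲-refl (var x)    = var x
≲-refl (ƛ t)      = ƛ (≲-refl t)
≲-refl (t · u)    = ≲-refl t · ≲-refl u
≲-refl (t [← u ]) = es (≲-refl t) (≲-refl u)

⊑⇒≲ : {t u : Tm n} → t ⊑ u → t ≲ u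
⊑⇒≲ t⊑u = ≲-refl _ then t⊑u

≲-rename : {t u : Tm n} (ρ : Fin n → Fin m) → t ≲ u → rename ρ t ≲ rename ρ u
≲-rename ρ (var x)                      = var (ρ x)
≲-rename ρ (ƛ t)                        = ƛ (≲-rename (lift 1 ρ) t)
≲-rename ρ (t · u)                      = ≲-rename ρ t · ≲-rename ρ u
≲-rename ρ (es t u)                     = es (≲-rename (lift 1 ρ) t) (≲-rename ρ u)
≲-rename ρ (_then_ {u = u} {s} t≲u u⊑s) = ≲-rename ρ t≲u then ⊑-rename {t = u} {s} ρ u⊑s

≲-exts : {σ τ : Fin n → Tm m} → (∀ x → σ x ≲ τ x) → ∀ x → exts σ x ≲ exts τ x
≲-exts σ≲τ zero    = var zero
≲-exts σ≲τ (suc x) = ≲-rename suc (σ≲τ x)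

-- In the `_then_` case the induction hypothesis passes from `σ` to `τ`, and ⊑ is then instantiated
-- at `τ`, hence the demand that `τ` consist of values.
≲-subst : {t u : Tm n} {σ τ : Fin n → Tm m} → (∀ x → Value (τ x)) → (∀ x → σ x ≲ τ x) →
          t ≲ u → subst σ t ≲ subst τ u
≲-subst vτ σ≲τ (var x)   = σ≲τ x
≲-subst vτ σ≲τ (ƛ t)     = ƛ (≲-subst (Value-exts vτ) (≲-exts σ≲τ) t)
≲-subst vτ σ≲τ (t · u)   = ≲-subst vτ σ≲τ t · ≲-subst vτ σ≲τ u
≲-subst vτ σ≲τ (es t u)  = es (≲-subst (Value-exts vτ) (≲-exts σ≲τ) t) (≲-subst vτ σ≲τ u)
≲-subst vτ σ≲τ (_then_ {u = u} {s} t≲u u⊑s) =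
  ≲-subst vτ σ≲τ t≲u then ⊑-subst {t = u} {s} vτ u⊑s

≲-⟪⟫ : {t t′ : Tm (suc n)} {c c′ : Tm (suc n)} → t ≲ t′ → c ≲ c′ → t ⟪ ƛ c ⟫ ≲ t′ ⟪ ƛ c′ ⟫
≲-⟪⟫ t≲t′ c≲c′ = ≲-subst (λ { zero → ƛ _ ; (suc x) → var x })
                        (λ { zero → ƛ c≲c′ ; (suc x) → var x }) t≲t′

-- Induction on the evaluation, then on the derivation of `≲`: for substituted bodies the latter may
-- grow, but the evaluation shrinks.
≲-simulation : {t u : Tm 0} {b : Tm 1} → t ⇩ b → t ≲ u → ∃ λ b′ → u ⇩ b′ × b ≲ b′
≲-simulation ƛ (ƛ b≲b′) = _ , ƛ , b≲b′
≲-simulation (app t⇩ u⇩ d⇩) (t≲t′ · u≲u′)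
  with _ , t′⇩ , b≲b′ ← ≲-simulation t⇩ t≲t′
     | _ , u′⇩ , c≲c′ ← ≲-simulation u⇩ u≲u′
  with _ , d′⇩ , d≲d′ ← ≲-simulation d⇩ (≲-⟪⟫ b≲b′ c≲c′)
  = _ , app t′⇩ u′⇩ d′⇩ , d≲d′
≲-simulation (es u⇩ d⇩) (es t≲t′ u≲u′)
  with _ , u′⇩ , c≲c′ ← ≲-simulation u⇩ u≲u′
  with _ , d′⇩ , d≲d′ ← ≲-simulation d⇩ (≲-⟪⟫ t≲t′ c≲c′)
  = _ , es u′⇩ d′⇩ , d≲d′
≲-simulation t⇩ (_then_ {u = u} {s} t≲u u⊑s)
  with _ , u⇩ , b≲b′ ← ≲-simulation t⇩ t≲u
  -- In scope 0 the empty substitution is closing, and ⊑ preserves the body, so `b≲b′` is reused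
  -- unchanged.
  = _ , transport (_⇩ _) (subst-id s λ ()) (u⊑s var var (transport (_⇩ _) (sym (subst-id u λ ())) u⇩)) , b≲b′

⟶⇒≲ : {t u : Tm n} → t ⟶ u → t ≲ u
⟶⇒≲ (rootₘ r)   = ⊑⇒≲ (↦ₘ⇒⊑ r)
⟶⇒≲ (rootₑ r)   = ⊑⇒≲ (↦ₑ⇒⊑ r)
⟶⇒≲ (appˡ r)    = ⟶⇒≲ r · ≲-refl _
⟶⇒≲ (appʳ r)    = ≲-refl _ · ⟶⇒≲ r
⟶⇒≲ (ƛ r)       = ƛ (⟶⇒≲ r)
⟶⇒≲ (esBody r)  = es (⟶⇒≲ r) (≲-refl _)
⟶⇒≲ (esArg r)   = es (≲-refl _) (⟶⇒≲ r)

⟶⇒≳ : {t u : Tm n} → t ⟶ u → u ≲ t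
⟶⇒≳ (rootₘ r)   = ⊑⇒≲ (↦ₘ⇒⊒ r)
⟶⇒≳ (rootₑ r)   = ⊑⇒≲ (↦ₑ⇒⊒ r)
⟶⇒≳ (appˡ r)    = ⟶⇒≳ r · ≲-refl _
⟶⇒≳ (appʳ r)    = ≲-refl _ · ⟶⇒≳ r
⟶⇒≳ (ƛ r)       = ƛ (⟶⇒≳ r)
⟶⇒≳ (esBody r)  = es (⟶⇒≳ r) (≲-refl _)
⟶⇒≳ (esArg r)   = es (≲-refl _) (⟶⇒≳ r)

-- Termination and contextual equivalence

I : Tm n
I = ƛ (var zero)

-- Filling all names with a fixed closed value makes `_⇩_` usable in every scope; a closed term only
-- changes its scope.
close : Tm n → Tm 0
close = subst (const I)

infix 4 _⇩∃

_⇩∃ : Tm n → Set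
t ⇩∃ = ∃ λ b → close t ⇩ b

≲-⇩∃ : {t u : Tm n} → t ≲ u → t ⇩∃ → u ⇩∃
≲-⇩∃ t≲u (_ , t⇩) with _ , u⇩ , _ ← ≲-simulation t⇩ (≲-subst (λ _ → ƛ _) (λ _ → ≲-refl I) t≲u) = _ , u⇩

-- Termination is pulled back across each step by `≲`, which takes the place of a standardization
-- argument.
⇓⇒⇩∃ : {t : Tm n} → t ⇓ → t ⇩∃
⇓⇒⇩∃ (_ , ε , v) with b , _ , v⇩ ← Value⇒⇩ (Value-subst (λ _ → ƛ _) v) = b , v⇩
⇓⇒⇩∃ (_ , r ◅ rs , v)                                                 = ≲-⇩∃ (⟶⇒≳ r) (⇓⇒⇩∃ (_ , rs , v))

⇩∃⇒⇓ : {t : Tm n} → Closed t → t ⇩∃ → t ⇓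
⇩∃⇒⇓ {t = t} c (b , t⇩) =
  _ , transport (_⟶* ƛ (rename (lift 1 λ ()) b)) rename-close (⇩⇒⟶* (⇩-rename (λ ()) t⇩)) , ƛ _
  where
  rename-close : rename (λ ()) (close t) ≡ t
  rename-close = trans (rename-subst t λ _ → refl) (subst-closed t c)

⇓⇔⇩∃ : {t : Tm n} → Closed t → t ⇓ ⇔ t ⇩∃
⇓⇔⇩∃ c = mk⇔ ⇓⇒⇩∃ (⇩∃⇒⇓ c)

-- Each remaining name is bound to `I`, the value that `close` would give it, so `_⇩∃` is
-- unaffected.
closeCtx : Ctx n m → Ctx n 0
closeCtx {m = zero}  C = C
closeCtx {m = suc m} C = closeCtx (esBody C I)

es-I-⇩∃ : (t : Tm (suc n)) → t [← I ] ⇩∃ ⇔ t ⇩∃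
es-I-⇩∃ t = mk⇔
  (λ { (b , es ƛ t⇩) → b , transport (_⇩ b) eq t⇩ })
  (λ { (b , t⇩) → b , es ƛ (transport (_⇩ b) (sym eq) t⇩) })
  where
  eq : subst (exts (const I)) t ⟪ I ⟫ ≡ close t
  eq = trans (subst-exts-⟪⟫ (const I) t I) (subst-cong t λ { zero → refl ; (suc _) → refl })

closeCtx-⇩∃ : (C : Ctx n m) (t : Tm n) → closeCtx C ⟨ t ⟩ ⇩∃ ⇔ C ⟨ t ⟩ ⇩∃
closeCtx-⇩∃ {m = zero}  C t = ⇔.refl
closeCtx-⇩∃ {m = suc m} C t = ⇔.trans (closeCtx-⇩∃ (esBody C I) t) (es-I-⇩∃ (C ⟨ t ⟩))

infix 4 _≅_

-- Free of closedness conditions, which obstruct transitivity: a context closing both outer terms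
-- may leave names of the middle term free.
_≅_ : Tm n → Tm n → Set
_≅_ {n} t u = ∀ {m} (C : Ctx n m) → C ⟨ t ⟩ ⇩∃ ⇔ C ⟨ u ⟩ ⇩∃

≅⇒=C : {t u : Tm n} → t ≅ u → t =C u
≅⇒=C t≅u C ct cu = ⇔.trans (⇓⇔⇩∃ ct) (⇔.trans (t≅u C) (⇔.sym (⇓⇔⇩∃ cu)))

-- closeCtx makes the closedness side conditions of =C vacuous.
=C⇒≅ : {t u : Tm n} → t =C u → t ≅ u
=C⇒≅ {t = t} {u} t=u C =
  ⇔.trans (⇔.sym (closeCtx-⇩∃ C t))
    (⇔.trans (⇔.sym (⇓⇔⇩∃ λ ()))
      (⇔.trans (t=u (closeCtx C) (λ ()) (λ ()))
        (⇔.trans (⇓⇔⇩∃ λ ()) (closeCtx-⇩∃ C u))))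

≲-⟨⟩ : (C : Ctx n m) {t u : Tm n} → t ≲ u → C ⟨ t ⟩ ≲ C ⟨ u ⟩
≲-⟨⟩ (hole ρ)     r = ≲-rename (Injection.to ρ) r
≲-⟨⟩ (appˡ C u)   r = ≲-⟨⟩ C r · ≲-refl u
≲-⟨⟩ (appʳ u C)   r = ≲-refl u · ≲-⟨⟩ C r
≲-⟨⟩ (ƛ C)        r = ƛ (≲-⟨⟩ C r)
≲-⟨⟩ (esBody C u) r = es (≲-⟨⟩ C r) (≲-refl u)
≲-⟨⟩ (esArg u C)  r = es (≲-refl u) (≲-⟨⟩ C r)

≲≳⇒=C : {t u : Tm n} → t ≲ u → u ≲ t → t =C u
≲≳⇒=C t≲u u≲t = ≅⇒=C λ C → mk⇔ (≲-⇩∃ (≲-⟨⟩ C t≲u)) (≲-⇩∃ (≲-⟨⟩ C u≲t))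

-- Composition of contexts

lift↣ : Fin n ↣ Fin m → Fin (suc n) ↣ Fin (suc m)
lift↣ ρ = mk↣ (lift-injective (Injection.to ρ) (Injection.injective ρ) 1)

-- The hole of an outer context renames what is plugged in, so composition has to rename the whole
-- inner context there.
renameCtx : Fin m ↣ Fin k → Ctx n m → Ctx n k
renameCtx ρ (hole θ)     = hole (ρ ↣-∘ θ)
renameCtx ρ (appˡ C u)   = appˡ (renameCtx ρ C) (rename (Injection.to ρ) u)
renameCtx ρ (appʳ u C)   = appʳ (rename (Injection.to ρ) u) (renameCtx ρ C)
renameCtx ρ (ƛ C)        = ƛ (renameCtx (lift↣ ρ) C)
renameCtx ρ (esBody C u) = esBody (renameCtx (lift↣ ρ) C) (rename (Injection.to ρ) u)
renameCtx ρ (esArg u C)  = esArg (rename (lift 1 (Injection.to ρ)) u) (renameCtx ρ C)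

renameCtx-⟨⟩ : (ρ : Fin m ↣ Fin k) (C : Ctx n m) (t : Tm n) →
               renameCtx ρ C ⟨ t ⟩ ≡ rename (Injection.to ρ) (C ⟨ t ⟩)
renameCtx-⟨⟩ ρ (hole θ)     t = sym (rename-rename t λ _ → refl)
renameCtx-⟨⟩ ρ (appˡ C u)   t = cong (_· _) (renameCtx-⟨⟩ ρ C t)
renameCtx-⟨⟩ ρ (appʳ u C)   t = cong (_ ·_) (renameCtx-⟨⟩ ρ C t)
renameCtx-⟨⟩ ρ (ƛ C)        t = cong ƛ (renameCtx-⟨⟩ (lift↣ ρ) C t)
renameCtx-⟨⟩ ρ (esBody C u) t = cong (_[← _ ]) (renameCtx-⟨⟩ (lift↣ ρ) C t)
renameCtx-⟨⟩ ρ (esArg u C)  t = cong (_ [←_]) (renameCtx-⟨⟩ ρ C t)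

infixr 9 _∘ᶜ_

_∘ᶜ_ : Ctx m k → Ctx n m → Ctx n k
hole ρ     ∘ᶜ C = renameCtx ρ C
appˡ D u   ∘ᶜ C = appˡ (D ∘ᶜ C) u
appʳ u D   ∘ᶜ C = appʳ u (D ∘ᶜ C)
ƛ D        ∘ᶜ C = ƛ (D ∘ᶜ C)
esBody D u ∘ᶜ C = esBody (D ∘ᶜ C) u
esArg u D  ∘ᶜ C = esArg u (D ∘ᶜ C)

∘ᶜ-⟨⟩ : (D : Ctx m k) (C : Ctx n m) (t : Tm n) → (D ∘ᶜ C) ⟨ t ⟩ ≡ D ⟨ C ⟨ t ⟩ ⟩
∘ᶜ-⟨⟩ (hole ρ)     C t = renameCtx-⟨⟩ ρ C t
∘ᶜ-⟨⟩ (appˡ D u)   C t = cong (_· _) (∘ᶜ-⟨⟩ D C t)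
∘ᶜ-⟨⟩ (appʳ u D)   C t = cong (_ ·_) (∘ᶜ-⟨⟩ D C t)
∘ᶜ-⟨⟩ (ƛ D)        C t = cong ƛ (∘ᶜ-⟨⟩ D C t)
∘ᶜ-⟨⟩ (esBody D u) C t = cong (_[← _ ]) (∘ᶜ-⟨⟩ D C t)
∘ᶜ-⟨⟩ (esArg u D)  C t = cong (_ [←_]) (∘ᶜ-⟨⟩ D C t)

≅-⟨⟩ : (C : Ctx n m) {t u : Tm n} → t ≅ u → C ⟨ t ⟩ ≅ C ⟨ u ⟩
≅-⟨⟩ C {t} {u} t≅u D
  rewrite sym (∘ᶜ-⟨⟩ D C t) | sym (∘ᶜ-⟨⟩ D C u) = t≅u (D ∘ᶜ C)

-- Scrutability

-- A nest of `beta` frames supplies `σ` one name at a time, `zero` being bound innermost; each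
-- closed argument is weakened from scope 0 to the scope outside its binder.
betas : (Fin m → Tm 0) → Ctx n m → Ctx n 0
betas {m = zero}  σ T = T
betas {m = suc m} σ T = betas (σ ∘ suc) (appˡ (ƛ T) (rename (λ ()) (σ zero)))

betas-Testing : (σ : Fin m → Tm 0) {T : Ctx n m} → Testing T → Testing (betas σ T)
betas-Testing {m = zero}  σ T = T
betas-Testing {m = suc m} σ T = betas-Testing (σ ∘ suc) (beta T _)

betas-⇩ : (σ : Fin m → Tm 0) → (∀ x → Value (σ x)) → (T : Ctx n m) {t : Tm n} {b : Tm 1} →
          subst σ (T ⟨ t ⟩) ⇩ b → betas σ T ⟨ t ⟩ ⇩ b
betas-⇩ {m = zero}  σ vσ T {t} t⇩ = transport (_⇩ _) (subst-id (T ⟨ t ⟩) λ ()) t⇩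
betas-⇩ {m = suc m} σ vσ T {t} t⇩ with c , eq , v⇩ ← Value⇒⇩ (vσ zero) =
  betas-⇩ (σ ∘ suc) (vσ ∘ suc) (appˡ (ƛ T) _)
    (app ƛ (transport (_⇩ c) (sym argument) v⇩) (transport (_⇩ _) (sym body) t⇩))
  where
  argument : subst (σ ∘ suc) (rename (λ ()) (σ zero)) ≡ σ zero
  argument = trans (subst-rename (σ zero) λ ()) (subst-id {σ = var} (σ zero) λ ())

  body : subst (exts (σ ∘ suc)) (T ⟨ t ⟩) ⟪ ƛ c ⟫ ≡ subst σ (T ⟨ t ⟩)
  body = trans (subst-exts-⟪⟫ (σ ∘ suc) (T ⟨ t ⟩) (ƛ c))
               (subst-cong (T ⟨ t ⟩) λ { zero → sym eq ; (suc _) → refl })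

⇩⇒Scrutable : (t : Tm n) (σ : Fin n → Tm 0) → (∀ x → Value (σ x)) → {b : Tm 1} →
              subst σ t ⇩ b → Scrutable t
⇩⇒Scrutable {n} t σ vσ t⇩ =
  0 , betas σ T , betas-Testing σ (hole (↣-id _)) ,
  _ , ⇩⇒⟶* (betas-⇩ σ vσ T (transport (_⇩ _) (cong (subst σ) (sym (rename-id t λ _ → refl))) t⇩)) , ƛ _
  where
  T : Ctx n n
  T = hole (↣-id _)

Inscrutable⇒≲ : {t : Tm n} → Inscrutable t → (u : Tm n) → t ≲ u
Inscrutable⇒≲ {t = t} ¬s u =
  ⊑⇒≲ {t = t} {u} λ σ vσ t⇩ → contradiction (⇩⇒Scrutable t σ vσ t⇩) ¬s

corollary6p4 : IsScrutableVSCTheory (λ n → _=C_ {n})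
corollary6p4 = record
  { isVSCTheory = record
    { isEquivalence = record
      { refl  = λ C _ _ → ⇔.refl
      ; sym   = λ t=u C cu ct → ⇔.sym (t=u C ct cu)
      ; trans = λ t=u u=s → ≅⇒=C λ C → ⇔.trans (=C⇒≅ t=u C) (=C⇒≅ u=s C)
      }
    ; contains-⟶ = λ r → ≲≳⇒=C (⟶⇒≲ r) (⟶⇒≳ r)
    ; closed     = λ C t=u → ≅⇒=C (≅-⟨⟩ C (=C⇒≅ t=u))
    }
  ; equates-inscrutable = λ it iu → ≲≳⇒=C (Inscrutable⇒≲ it _) (Inscrutable⇒≲ iu _)
  }
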